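{- There is no distance-regular graph with intersection array $\{55,54,50,35,10;1,5,20,45,55\}$.
   Context: A connected graph $\Gamma$ of diameter $d$ is distance-regular if there are constants $p^h_{ij}$ ($0\le h,i,j\le d$) such that for any two vertices $u,v$ at distance $h$, the number of vertices at distance $i$ from $u$ and distance $j$ from $v$ is $p^h_{ij}$. Its intersection array is $\{b_0,b_1,\dots,b_{d-1};c_1,c_2,\dots,c_d\}$ where $b_i=p^i_{1,i+1}$ and $c_{i+1}=p^{i+1}_{1,i}$. -}

module Defs where

open import Level using (Level; _⊔_)
open import Data.Nat using (ℕ; zero; suc; _≤_; _+_)
open import Data.List using (List; length)
open import Data.List.Membership.Propositional using (_∈_)
open import Data.List.Relation.Unary.Unique.Propositional using (Unique)
open import Data.Product using (Σ; ∃; _×_; _,_)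
open import Function.Bundles using (_⇔_)
open import Relation.Binary.PropositionalEquality using (_≡_)
open import Relation.Nullary using (¬_)

record Graph {a} (V : Set a) (ℓ : Level) : Set (a ⊔ Level.suc ℓ) where
  field
    Adj     : V → V → Set ℓ
    symm    : ∀ {x y} → Adj x y → Adj y x
    irrefl  : ∀ {x} → ¬ Adj x x

module _ {a ℓ} {V : Set a} (G : Graph V ℓ) where
  open Graph G

  data Walk : V → V → ℕ → Set (a ⊔ ℓ) where
    here : ∀ {u} → Walk u u zero
    step : ∀ {u w v k} → Adj u w → Walk w v k → Walk u v (suc k)

  Dist : V → V → ℕ → Set (a ⊔ ℓ)
  Dist u v k = Walk u v k × (∀ j → Walk u v j → k ≤ j)

  Connected : Set (a ⊔ ℓ)
  Connected = ∀ u v → ∃ λ k → Walk u v k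

  HasDiameter : ℕ → Set (a ⊔ ℓ)
  HasDiameter d = (∀ u v k → Dist u v k → k ≤ d) × (Σ V λ u → Σ V λ v → Dist u v d)

HasCard : ∀ {a p} {V : Set a} → (V → Set p) → ℕ → Set (a ⊔ p)
HasCard {V = V} P c = Σ (List V) λ xs → Unique xs × (∀ w → (w ∈ xs) ⇔ P w) × length xs ≡ c

module _ {a ℓ} {V : Set a} (G : Graph V ℓ) where

  IntersectionNumbers : ℕ → (ℕ → ℕ → ℕ → ℕ) → Set (a ⊔ ℓ)
  IntersectionNumbers d p =
    ∀ h i j → h ≤ d → i ≤ d → j ≤ d → ∀ u v → Dist G u v h →
      HasCard (λ w → Dist G u w i × Dist G v w j) (p h i j)

  -- G is distance-regular of diameter d with intersection array
  -- {b 0, …, b (d-1); c 1, …, c d}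
  DistanceRegularWithArray : (d : ℕ) → (b c : ℕ → ℕ) → Set (a ⊔ ℓ)
  DistanceRegularWithArray d b c =
    Connected G × HasDiameter G d ×
    Σ (ℕ → ℕ → ℕ → ℕ) λ p → IntersectionNumbers d p ×
      (∀ i → suc i ≤ d → b i ≡ p i 1 (suc i) × c (suc i) ≡ p (suc i) 1 i)

bArr : ℕ → ℕ
bArr 0 = 55
bArr 1 = 54
bArr 2 = 50
bArr 3 = 35
bArr 4 = 10
bArr _ = 0

cArr : ℕ → ℕ
cArr 1 = 1
cArr 2 = 5
cArr 3 = 20
cArr 4 = 45
cArr 5 = 55
cArr _ = 0

{-# OPTIONS --safe #-}
module Submission where

-- Let E and F be the projections onto the eigenspace of the eigenvalue 20 and onto the
-- sum of the eigenspaces of −5, −20, −55. The Krein parameters of (20, 20, θ) vanish for these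
-- three θ, so the sum over x of E(u,x) E(v,x) F(w,x) is zero for all u, v, w: the sum of the
-- squares of these numbers is a multiple of the sum over x, y of E(x,y)² F(x,y). For pairwise
-- distances 2 this says 12α + γ = 20, where α and γ count the vertices at distance 1,
-- respectively 5, from all of u, v, w; hence α ≤ 1. But c₂ = 5 provides two vertices with
-- three common neighbours u, v, w, for which α ≥ 2.

open import Defs
open import Relation.Nullary using (¬_; Dec; yes; no; does; contradiction)

open import Data.Bool using (true; false; if_then_else_)
open import Data.Empty using (⊥; ⊥-elim)
open import Data.Integer as ℤ using (ℤ; +_; -_; _+_; _*_; 0ℤ; 1ℤ; +≤+)
import Data.Integer.Properties as ℤ
open import Data.Integer.Tactic.RingSolver using (solve-∀)
open import Data.List using (List; []; _∷_; [_]; _++_; length; filter; upTo; deduplicate; zipWith; map; foldr)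
open import Data.List.Membership.Propositional using (_∈_)
open import Data.List.Membership.Propositional.Properties using (∈-∃++; ∈-++⁺ˡ; ∈-++⁺ʳ; ∈-++⁻; ∈-filter⁺; ∈-filter⁻; ∈-deduplicate⁺; ∈-upTo⁺)
open import Data.List.Properties using (length-++)
open import Data.List.Relation.Unary.All as All using (All; []; _∷_)
open import Data.List.Relation.Unary.AllPairs using ([]; _∷_)
open import Data.List.Relation.Unary.Any using (here; there)
open import Data.List.Relation.Unary.Unique.Propositional using (Unique)
import Data.List.Relation.Unary.Unique.Propositional.Properties as Unique
import Data.List.Relation.Unary.Unique.DecPropositional.Properties as UniqueDec
open import Data.Nat as ℕ using (ℕ; zero; suc; _≤_; z≤n; s≤s)
import Data.Nat.Properties as ℕ
open import Data.Product using (∃; _×_; _,_; proj₁; proj₂)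
open import Data.Sum using (_⊎_; inj₁; inj₂; [_,_]′)
open import Function.Base using (_∘_; id)
open import Function.Bundles using (_⇔_; Equivalence; mk⇔)
open import Level using (Level)
open import Relation.Binary.PropositionalEquality using (_≡_; _≢_; refl; sym; trans; cong; cong₂; subst; module ≡-Reasoning)
open import Relation.Nullary.Decidable using (True; toWitness; toWitnessFalse; _×-dec_; dec-true; dec-false)
open import Relation.Unary using (Pred; Decidable)

private variable
  a p : Level
  A : Set a

-- Counting with duplicate-free lists, and integer sums over lists.

module _ {A : Set a} where

  ∈-insert⁻ : ∀ xs {ys} {x z : A} → z ∈ xs ++ [ x ] ++ ys → z ≡ x ⊎ z ∈ xs ++ ys
  ∈-insert⁻ xs z∈ with ∈-++⁻ xs z∈
  ... | inj₁ z∈xs          = inj₂ (∈-++⁺ˡ z∈xs)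
  ... | inj₂ (here z≡x)    = inj₁ z≡x
  ... | inj₂ (there z∈ys)  = inj₂ (∈-++⁺ʳ xs z∈ys)

  ∈-delete : ∀ xs {ys} {x z : A} → z ≢ x → z ∈ xs ++ [ x ] ++ ys → z ∈ xs ++ ys
  ∈-delete xs z≢x = [ (λ z≡x → contradiction z≡x z≢x) , id ]′ ∘ ∈-insert⁻ xs

  length-insert : ∀ xs {ys} {x : A} → length (xs ++ [ x ] ++ ys) ≡ suc (length (xs ++ ys))
  length-insert []       = refl
  length-insert (_ ∷ xs) = cong suc (length-insert xs)

  unique⊆-length : ∀ {xs ys : List A} → Unique xs → (∀ {z} → z ∈ xs → z ∈ ys) →
                   length xs ≤ length ys
  unique⊆-length [] _ = z≤n
  unique⊆-length {x ∷ xs} (x∉xs ∷ xs!) xs⊆ys with ∈-∃++ (xs⊆ys (here refl))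
  ... | ys₁ , ys₂ , refl = subst (suc (length xs) ≤_) (sym (length-insert ys₁))
    (s≤s (unique⊆-length xs! λ z∈xs →
      ∈-delete ys₁ (λ { refl → All.lookup x∉xs z∈xs refl }) (xs⊆ys (there z∈xs))))

  -- Pigeonhole for lists. It turns an equality between the valency and a sum of intersection
  -- numbers into the statement that the neighbours so counted are all the neighbours.
  unique⊆-full : ∀ {xs ys : List A} → Unique xs → (∀ {z} → z ∈ xs → z ∈ ys) →
                 length ys ≤ length xs → ∀ {z} → z ∈ ys → z ∈ xs
  unique⊆-full {ys = []} [] _ _ ()
  unique⊆-full {x ∷ xs} (x∉xs ∷ xs!) xs⊆ys ys≤xs z∈ys with ∈-∃++ (xs⊆ys (here refl))
  ... | ys₁ , ys₂ , refl with ∈-insert⁻ ys₁ z∈ys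
  ... | inj₁ z≡x = here z≡x
  ... | inj₂ z∈  = there (unique⊆-full xs!
    (λ w∈xs → ∈-delete ys₁ (λ { refl → All.lookup x∉xs w∈xs refl }) (xs⊆ys (there w∈xs)))
    (ℕ.≤-pred (subst (_≤ suc (length xs)) (length-insert ys₁) ys≤xs)) z∈)

  ∑ : List A → (A → ℤ) → ℤ
  ∑ []       f = 0ℤ
  ∑ (x ∷ xs) f = f x + ∑ xs f

  ∑-cong : ∀ xs {f g : A → ℤ} → (∀ x → f x ≡ g x) → ∑ xs f ≡ ∑ xs g
  ∑-cong []       eq = refl
  ∑-cong (x ∷ xs) eq = cong₂ _+_ (eq x) (∑-cong xs eq)

  ∑-zero : ∀ xs → ∑ xs (λ _ → 0ℤ) ≡ 0ℤ
  ∑-zero []       = refl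
  ∑-zero (x ∷ xs) = trans (ℤ.+-identityˡ _) (∑-zero xs)

  ∑-+ : ∀ xs (f g : A → ℤ) → ∑ xs (λ x → f x + g x) ≡ ∑ xs f + ∑ xs g
  ∑-+ []       f g = refl
  ∑-+ (x ∷ xs) f g = trans (cong (_+_ (f x + g x)) (∑-+ xs f g)) (interchange (f x) (g x) _ _)
    where
    interchange : ∀ i j k l → i + j + (k + l) ≡ i + k + (j + l)
    interchange = solve-∀

  ∑-*ˡ : ∀ xs c (f : A → ℤ) → ∑ xs (λ x → c * f x) ≡ c * ∑ xs f
  ∑-*ˡ []       c f = sym (ℤ.*-zeroʳ c)
  ∑-*ˡ (x ∷ xs) c f = trans (cong (_+_ (c * f x)) (∑-*ˡ xs c f)) (sym (ℤ.*-distribˡ-+ c _ _))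

  ∑-*ʳ : ∀ xs c (f : A → ℤ) → ∑ xs (λ x → f x * c) ≡ ∑ xs f * c
  ∑-*ʳ xs c f = trans (∑-cong xs (λ x → ℤ.*-comm (f x) c)) (trans (∑-*ˡ xs c f) (ℤ.*-comm c _))

  ∑-mono : ∀ xs {f g : A → ℤ} → (∀ x → f x ℤ.≤ g x) → ∑ xs f ℤ.≤ ∑ xs g
  ∑-mono []       f≤g = ℤ.≤-refl
  ∑-mono (x ∷ xs) f≤g = ℤ.+-mono-≤ (f≤g x) (∑-mono xs f≤g)

  ∑-nonNeg : ∀ xs {f : A → ℤ} → (∀ x → 0ℤ ℤ.≤ f x) → 0ℤ ℤ.≤ ∑ xs f
  ∑-nonNeg xs {f} 0≤f = subst (λ i → i ℤ.≤ ∑ xs f) (∑-zero xs) (∑-mono xs 0≤f)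

  ∑-nonNeg-zero : ∀ {xs} {f : A → ℤ} → (∀ x → 0ℤ ℤ.≤ f x) → ∑ xs f ≡ 0ℤ →
                  ∀ {x} → x ∈ xs → f x ≡ 0ℤ
  ∑-nonNeg-zero {xs} {f} 0≤f ∑≡0 {x} x∈xs = ℤ.≤-antisym (subst (f x ℤ.≤_) ∑≡0 (bound x∈xs)) (0≤f x)
    where
    bound : ∀ {xs x} → x ∈ xs → f x ℤ.≤ ∑ xs f
    bound {y ∷ xs} (here refl) = subst (ℤ._≤ f y + ∑ xs f) (ℤ.+-identityʳ (f y)) (ℤ.+-monoʳ-≤ (f y) (∑-nonNeg xs 0≤f))
    bound {y ∷ xs} (there x∈) = ℤ.≤-trans (bound x∈)
      (subst (ℤ._≤ f y + ∑ xs f) (ℤ.+-identityˡ _) (ℤ.+-monoˡ-≤ (∑ xs f) (0≤f y)))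

∑-comm : ∀ {b} {B : Set b} xs ys (f : A → B → ℤ) →
         ∑ xs (λ x → ∑ ys (f x)) ≡ ∑ ys (λ y → ∑ xs (λ x → f x y))
∑-comm []       ys f = sym (∑-zero ys)
∑-comm (x ∷ xs) ys f = trans (cong (_+_ (∑ ys (f x))) (∑-comm xs ys f)) (sym (∑-+ ys (f x) _))

[_?] : ∀ {P : Set p} → Dec P → ℤ
[ P? ?] = if does P? then 1ℤ else 0ℤ

∑-indicator : ∀ xs {P : Pred A p} (P? : Decidable P) → ∑ xs (λ x → [ P? x ?]) ≡ + length (filter P? xs)
∑-indicator []       P? = refl
∑-indicator (x ∷ xs) P? with does (P? x)
... | true  = cong (_+_ 1ℤ) (∑-indicator xs P?)
... | false = trans (ℤ.+-identityˡ _) (∑-indicator xs P?)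

square-nonNeg : ∀ i → 0ℤ ℤ.≤ i * i
square-nonNeg (+ n)        = subst (0ℤ ℤ.≤_) (ℤ.pos-* n n) (+≤+ z≤n)
square-nonNeg (ℤ.-[1+ n ]) = +≤+ z≤n

square-zero : ∀ i → i * i ≡ 0ℤ → i ≡ 0ℤ
square-zero i eq = [ id , id ]′ (ℤ.i*j≡0⇒i≡0∨j≡0 i eq)

-- Reproducing kernels and vanishing triple products.

module Kernels {V : Set a} (vs : List V) where

  ∑² : (V → V → ℤ) → ℤ
  ∑² K = ∑ vs λ x → ∑ vs λ y → K x y

  ∑²-cong : ∀ {K L : V → V → ℤ} → (∀ x y → K x y ≡ L x y) → ∑² K ≡ ∑² L
  ∑²-cong eq = ∑-cong vs λ x → ∑-cong vs (eq x)

  ∑-square : ∀ (h : V → ℤ) → ∑ vs h * ∑ vs h ≡ ∑² λ x y → h x * h y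
  ∑-square h = trans (sym (∑-*ʳ vs (∑ vs h) h)) (∑-cong vs λ x → sym (∑-*ˡ vs (h x) h))

  Reproducing : ℤ → (V → V → ℤ) → Set a
  Reproducing c K = ∀ x y → ∑ vs (λ u → K u x * K u y) ≡ K x y * c

  -- Sums out one outer variable `u`: its two factors merge into one kernel value, while `L` holds
  -- everything that does not involve `u`.
  ∑-reproducing : ∀ c K → Reproducing c K → (L : V → V → ℤ) →
    ∑ vs (λ u → ∑² λ x y → K u x * K u y * L x y) ≡ ∑² λ x y → K x y * c * L x y
  ∑-reproducing c K rep L = begin
    ∑ vs (λ u → ∑ vs λ x → ∑ vs λ y → K u x * K u y * L x y)
      ≡⟨ ∑-comm vs vs _ ⟩
    ∑ vs (λ x → ∑ vs λ u → ∑ vs λ y → K u x * K u y * L x y)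
      ≡⟨ ∑-cong vs (λ x → ∑-comm vs vs _) ⟩
    ∑² (λ x y → ∑ vs λ u → K u x * K u y * L x y)
      ≡⟨ ∑²-cong (λ x y → trans (∑-*ʳ vs (L x y) λ u → K u x * K u y) (cong (_* L x y) (rep x y))) ⟩
    ∑² (λ x y → K x y * c * L x y) ∎
    where open ≡-Reasoning

  -- The sum over all u, v, w of the square of the left-hand side is a multiple of the
  -- double sum in the hypothesis (for idempotents of a scheme: a Krein parameter).
  triple-product-vanishes : ∀ a b c K L M →
    Reproducing a K → Reproducing b L → Reproducing c M →
    ∑² (λ x y → K x y * L x y * M x y) ≡ 0ℤ →
    ∀ {u v w} → u ∈ vs → v ∈ vs → w ∈ vs →
    ∑ vs (λ x → K u x * L v x * M w x) ≡ 0ℤ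
  triple-product-vanishes a b c K L M repK repL repM zero′ {u} {v} {w} u∈ v∈ w∈ =
    square-zero (t u v w)
      (∑-nonNeg-zero (λ w → square-nonNeg (t u v w))
        (∑-nonNeg-zero (λ v → ∑-nonNeg vs λ w → square-nonNeg (t u v w))
          (∑-nonNeg-zero (λ u → ∑-nonNeg vs λ v → ∑-nonNeg vs λ w → square-nonNeg (t u v w))
            total u∈) v∈) w∈)
    where
    open ≡-Reasoning
    t : V → V → V → ℤ
    t u v w = ∑ vs (λ x → K u x * L v x * M w x)

    regroup : ∀ k l m k′ l′ m′ → k * l * m * (k′ * l′ * m′) ≡ m * m′ * (l * l′ * (k * k′))
    regroup = solve-∀
    swap : ∀ m l k → m * (l * k) ≡ l * (m * k)
    swap = solve-∀
    rotate : ∀ m l k → l * (m * k) ≡ k * (m * l)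
    rotate = solve-∀
    collect : ∀ a b c k l m → k * a * (m * c * (l * b)) ≡ k * l * m * (a * b * c)
    collect = solve-∀

    total : ∑ vs (λ u → ∑ vs λ v → ∑ vs λ w → t u v w * t u v w) ≡ 0ℤ
    -- Each square becomes a double sum over `x`, `y`. Then `w`, `v`, `u` are summed out in this
    -- order; each regrouping brings the factors with the next variable to the front.
    total = begin
      ∑ vs (λ u → ∑ vs λ v → ∑ vs λ w → t u v w * t u v w)
        ≡⟨ (∑-cong vs λ u → ∑-cong vs λ v → ∑-cong vs λ w → trans (∑-square _)
             (∑²-cong λ x y → regroup (K u x) (L v x) (M w x) (K u y) (L v y) (M w y))) ⟩
      ∑ vs (λ u → ∑ vs λ v → ∑ vs λ w → ∑² λ x y →
        M w x * M w y * (L v x * L v y * (K u x * K u y)))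
        ≡⟨ (∑-cong vs λ u → ∑-cong vs λ v → trans (∑-reproducing c M repM _)
             (∑²-cong λ x y → swap (M x y * c) (L v x * L v y) (K u x * K u y))) ⟩
      ∑ vs (λ u → ∑ vs λ v → ∑² λ x y → L v x * L v y * (M x y * c * (K u x * K u y)))
        ≡⟨ (∑-cong vs λ u → trans (∑-reproducing b L repL _)
             (∑²-cong λ x y → rotate (M x y * c) (L x y * b) (K u x * K u y))) ⟩
      ∑ vs (λ u → ∑² λ x y → K u x * K u y * (M x y * c * (L x y * b)))
        ≡⟨ trans (∑-reproducing a K repK _)
             (∑²-cong λ x y → collect a b c (K x y) (L x y) (M x y)) ⟩
      ∑² (λ x y → K x y * L x y * M x y * (a * b * c))
        ≡⟨ trans (∑-cong vs λ x → ∑-*ʳ vs (a * b * c) _) (∑-*ʳ vs (a * b * c) _) ⟩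
      ∑² (λ x y → K x y * L x y * M x y) * (a * b * c)
        ≡⟨ cong (_* (a * b * c)) zero′ ⟩
      0ℤ ∎

-- Matrices of the Bose-Mesner algebra as functions of the distance.

-- Distances from a fixed vertex open to the neighbours of a vertex at distance `m`; `m` itself is
-- absent by bipartiteness. `near 5` also lists 6, which never occurs.
near : ℕ → List ℕ
near zero    = [ 1 ]
near (suc m) = m ∷ suc (suc m) ∷ []

-- Multiplication by the adjacency matrix. There is no term in `g h`, as bₕ + cₕ is the whole
-- valency. At distance 5 the value `g 6` gets the coefficient `bArr 5`, which is 0.
T : (ℕ → ℤ) → ℕ → ℤ
T g zero    = + bArr 0 * g 1
T g (suc h) = + cArr (suc h) * g h + + bArr (suc h) * g (suc (suc h))

δ : ℕ → ℕ → ℤ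
δ i h = [ i ℕ.≟ h ?]

δ-hit : ∀ {i h} → i ≡ h → δ i h ≡ 1ℤ
δ-hit {i} {h} i≡h = cong (if_then 1ℤ else 0ℤ) (dec-true (i ℕ.≟ h) i≡h)

δ-miss : ∀ {i h} → i ≢ h → δ i h ≡ 0ℤ
δ-miss {i} {h} i≢h = cong (if_then 1ℤ else 0ℤ) (dec-false (i ℕ.≟ h) i≢h)

δ-cong : ∀ i {h s t} → (h ≡ i → s ≡ t) → δ i h * s ≡ δ i h * t
δ-cong i {h} {s} {t} eq with i ℕ.≟ h
... | yes i≡h = cong (δ i h *_) (eq (sym i≡h))
... | no  i≢h = trans (cong (_* s) (δ-miss i≢h)) (cong (_* t) (sym (δ-miss i≢h)))

near-expand : ∀ (g : ℕ → ℤ) {h j} → j ∈ near (suc h) →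
              g j ≡ δ h j * g h + δ (suc (suc h)) j * g (suc (suc h))
near-expand g {h} (here refl)
  rewrite δ-hit {h} refl | δ-miss {suc (suc h)} {h} (λ ()) =
  sym (trans (ℤ.+-identityʳ _) (ℤ.*-identityˡ _))
near-expand g {h} (there (here refl))
  rewrite δ-hit {suc (suc h)} refl | δ-miss {h} {suc (suc h)} (λ ()) =
  sym (trans (ℤ.+-identityˡ _) (ℤ.*-identityˡ _))

-- Horner's scheme for a polynomial in the adjacency matrix, applied to `g`. As `δ 0` is the
-- identity matrix, `act cs (δ 0)` is the polynomial itself.
act : List ℤ → (ℕ → ℤ) → ℕ → ℤ
act []       g h = 0ℤ
act (c ∷ cs) g h = c * g h + T (act cs g) h

scale : ℤ
scale = + 247500

-- The distance polynomials vᵢ, for which vᵢ(A) is the distance-i matrix, multiplied by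
-- c₁c₂c₃c₄c₅ = 247500 to clear denominators; constant terms first.
distancePolynomials : List (List ℤ)
distancePolynomials =
  (+ 247500 ∷ []) ∷
  (0ℤ ∷ + 247500 ∷ []) ∷
  (- + 2722500 ∷ 0ℤ ∷ + 49500 ∷ []) ∷
  (0ℤ ∷ - + 804375 ∷ 0ℤ ∷ + 2475 ∷ []) ∷
  (+ 3025000 ∷ 0ℤ ∷ - + 72875 ∷ 0ℤ ∷ + 55 ∷ []) ∷
  (0ℤ ∷ + 566875 ∷ 0ℤ ∷ - + 2900 ∷ 0ℤ ∷ 1ℤ ∷ []) ∷ []

_⊕_ : List ℤ → List ℤ → List ℤ
[]       ⊕ ds       = ds
(c ∷ cs) ⊕ []       = c ∷ cs
(c ∷ cs) ⊕ (d ∷ ds) = c + d ∷ cs ⊕ ds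

polynomial : (ℕ → ℤ) → List ℤ
polynomial φ = foldr _⊕_ [] (zipWith (λ i cs → map (φ i *_) cs) (upTo 6) distancePolynomials)

AgreeUpTo5 : (φ ψ : ℕ → ℤ) → Set
AgreeUpTo5 φ ψ = ∀ {h} → h ≤ 5 → φ h ≡ ψ h

agree : ∀ φ ψ → True (All.all? (λ h → φ h ℤ.≟ ψ h) (upTo 6)) → AgreeUpTo5 φ ψ
agree φ ψ ok h≤5 = All.lookup (toWitness ok) (∈-upTo⁺ (s≤s h≤5))

-- The coefficients are certified separately for each `φ` in use, by evaluation at the six distances
-- during type checking.
IsPolynomial : (ℕ → ℤ) → Set
IsPolynomial φ = AgreeUpTo5 (λ h → φ h * scale) (act (polynomial φ) (δ 0))

isPolynomial : ∀ φ → _ → IsPolynomial φ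
isPolynomial φ = agree (λ h → φ h * scale) (act (polynomial φ) (δ 0))

-- By `convolution` the left-hand side stands for `scale` times the square of the matrix `φ`, so
-- that matrix is `c` times an idempotent.
IsIdempotent : ℤ → (ℕ → ℤ) → Set
IsIdempotent c φ = AgreeUpTo5 (act (polynomial φ) φ) (λ h → φ h * c * scale)

isIdempotent : ∀ c φ → _ → IsIdempotent c φ
isIdempotent c φ = agree (act (polynomial φ) φ) (λ h → φ h * c * scale)

-- The concrete matrices for this array.

table : List ℤ → ℕ → ℤ
table []       _       = 0ℤ
table (c ∷ cs) zero    = c
table (c ∷ cs) (suc h) = table cs h

-- 198 times the cosine sequence of the eigenvalue 20.
g : ℕ → ℤ
g = table (+ 198 ∷ + 72 ∷ + 23 ∷ + 2 ∷ - + 12 ∷ - + 33 ∷ [])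

-- 250 times the orthogonal projection onto the eigenspaces of −5, −20 and −55.
f : ℕ → ℤ
f = table (+ 125 ∷ - + 14 ∷ 0ℤ ∷ 1ℤ ∷ 0ℤ ∷ - + 4 ∷ [])

-- Half the difference between `g` and its sign-alternated copy, which belongs to the eigenvalue
-- -20.
g-odd : ℕ → ℤ
g-odd = table (0ℤ ∷ + 72 ∷ 0ℤ ∷ + 2 ∷ 0ℤ ∷ - + 33 ∷ [])

-- 66125 = 125 · 23² is the value of g g f at distances (2, 2, 0).
k : ℕ → ℤ
k = table (+ 66125 ∷ - + 60 ∷ 0ℤ ∷ 0ℤ ∷ 0ℤ ∷ - + 20 ∷ [])

g-polynomial : IsPolynomial g
g-polynomial = isPolynomial g _

f-polynomial : IsPolynomial f
f-polynomial = isPolynomial f _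

g-odd-polynomial : IsPolynomial g-odd
g-odd-polynomial = isPolynomial g-odd _

k-polynomial : IsPolynomial k
k-polynomial = isPolynomial k _

δ₀-polynomial : IsPolynomial (δ 0)
δ₀-polynomial = isPolynomial (δ 0) _

δ₁-polynomial : IsPolynomial (δ 1)
δ₁-polynomial = isPolynomial (δ 1) _

δ₅-polynomial : IsPolynomial (δ 5)
δ₅-polynomial = isPolynomial (δ 5) _

-- 5250 = 198 · 3500 / 132, from 3500 vertices and the multiplicity 132 of the eigenvalue 20.
g-idempotent : IsIdempotent (+ 5250) g
g-idempotent = isIdempotent (+ 5250) g _

f-idempotent : IsIdempotent (+ 250) f
f-idempotent = isIdempotent (+ 250) f _

-- The pointwise inequality.

common : ℕ → ℕ → ℕ → ℤ
common r s t = δ 1 r * δ 1 s * δ 1 t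

-- Each term involves at most two of the three distances, so its sum over all vertices is a matrix
-- entry fixed by the mutual distance of two vertices. The factor `1ℤ` gives `k t` this shape too.
pairwise : ℕ → ℕ → ℕ → ℤ
pairwise r s t = g-odd r * g s + (k t * 1ℤ +
  ((δ 0 t * δ 0 r + δ 0 t * δ 0 s) * + 5000000 +
  ((δ 1 t * δ 1 r + δ 1 t * δ 1 s) * - + 2100 + (δ 5 t * δ 5 r + δ 5 t * δ 5 s) * + 350)))

-- Expand g g f on odd distances via g = 2 + 70 δ₁ − 35 δ₅ and f = 1 − 15 δ₁ − 5 δ₅. Distances
-- 1 and 5 do not occur together, so the only genuinely ternary terms left are
-- −73500 δ₁δ₁δ₁ and −6125 δ₅δ₅δ₅; the latter is dropped, hence the inequality.
-- The terms δ₀δ₀ in pairwise, whose coefficient is any large number, make up for the triples with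
-- t = 0 other than (2, 2, 0); they contribute nothing to a sum over the vertices.
ternary-bound : ∀ {m r s t} → m ≤ 5 → r ∈ near m → s ∈ near m → t ∈ near m →
  g r * g s * f t + common r s t * + 73500 ℤ.≤ pairwise r s t
ternary-bound m≤5 r∈ s∈ t∈ = All.lookup (All.lookup (All.lookup (All.lookup
  (toWitness {a? = All.all? (λ m → All.all? (λ r → All.all? (λ s → All.all? (λ t →
     g r * g s * f t + common r s t * + 73500 ℤ.≤? pairwise r s t)
     (near m)) (near m)) (near m)) (upTo 6)} _)
  (∈-upTo⁺ (s≤s m≤5))) r∈) s∈) t∈

common-nonNeg : ∀ r s t → 0ℤ ℤ.≤ common r s t
common-nonNeg r s t with does (1 ℕ.≟ r) | does (1 ℕ.≟ s) | does (1 ℕ.≟ t)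
... | false | _     | _     = ℤ.≤-refl
... | true  | false | _     = ℤ.≤-refl
... | true  | true  | false = ℤ.≤-refl
... | true  | true  | true  = +≤+ z≤n

-- Walks, distances and bipartiteness.

module Distances {a ℓ : Level} {V : Set a} (G : Graph V ℓ)
                 (drg : DistanceRegularWithArray G 5 bArr cArr) where
  open Graph G

  connected : Connected G
  connected = proj₁ drg

  d≤5 : ∀ u v k → Dist G u v k → k ≤ 5
  d≤5 = proj₁ (proj₁ (proj₂ drg))

  p-numbers : ℕ → ℕ → ℕ → ℕ
  p-numbers = proj₁ (proj₂ (proj₂ drg))

  card : IntersectionNumbers G 5 p-numbers
  card = proj₁ (proj₂ (proj₂ (proj₂ drg)))

  b-card : ∀ h → suc h ≤ 5 → ∀ {u v} → Dist G u v h →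
           HasCard (λ w → Dist G u w 1 × Dist G v w (suc h)) (bArr h)
  b-card h h<5 uv = subst (HasCard _) (sym (proj₁ (proj₂ (proj₂ (proj₂ (proj₂ drg))) h h<5)))
    (card h 1 (suc h) (ℕ.<⇒≤ h<5) (s≤s z≤n) h<5 _ _ uv)

  c-card : ∀ h → suc h ≤ 5 → ∀ {u v} → Dist G u v (suc h) →
           HasCard (λ w → Dist G u w 1 × Dist G v w h) (cArr (suc h))
  c-card h h<5 uv = subst (HasCard _) (sym (proj₂ (proj₂ (proj₂ (proj₂ (proj₂ drg))) h h<5)))
    (card (suc h) 1 h h<5 (s≤s z≤n) (ℕ.<⇒≤ h<5) _ _ uv)

  _∷ʳʷ_ : ∀ {u v w k} → Walk G u v k → Adj v w → Walk G u w (suc k)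
  here       ∷ʳʷ e = step e here
  step e′ vs ∷ʳʷ e = step e′ (vs ∷ʳʷ e)

  reverseʷ : ∀ {u v k} → Walk G u v k → Walk G v u k
  reverseʷ here        = here
  reverseʷ (step e vs) = reverseʷ vs ∷ʳʷ symm e

  Dist-sym : ∀ {u v k} → Dist G u v k → Dist G v u k
  Dist-sym (uv , min) = reverseʷ uv , λ j → min j ∘ reverseʷ

  Dist-unique : ∀ {u v j k} → Dist G u v j → Dist G u v k → j ≡ k
  Dist-unique (uv , min) (uv′ , min′) = ℕ.≤-antisym (min _ uv′) (min′ _ uv)

  Dist-refl : ∀ {u} → Dist G u u 0
  Dist-refl = here , λ _ _ → z≤n

  Dist₀⇒≡ : ∀ {u v} → Dist G u v 0 → u ≡ v
  Dist₀⇒≡ (here , _) = refl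

  Dist₁⇒Adj : ∀ {u v} → Dist G u v 1 → Adj u v
  Dist₁⇒Adj (step e here , _) = e

  Adj⇒Dist₁ : ∀ {u v} → Adj u v → Dist G u v 1
  Adj⇒Dist₁ {u} e = step e here , λ { zero here → ⊥-elim (irrefl e) ; (suc j) _ → s≤s z≤n }

  neighbours : ∀ v → HasCard (λ w → Dist G v w 1 × Dist G v w 1) 55
  neighbours v = b-card 0 (s≤s z≤n) Dist-refl

  -- The graph is bipartite: bᵢ + cᵢ exhausts the valency.
  adj-near : ∀ {u v w i} → Dist G u v i → Adj v w → ∃ λ j → j ∈ near i × Dist G u w j
  adj-near {i = zero} uv e with Dist₀⇒≡ uv
  ... | refl = 1 , here refl , Adj⇒Dist₁ e
  adj-near {u} {v} {w} {suc i} uv e = split i (d≤5 u v _ uv) uv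
    where
    inner : ∀ i → suc (suc i) ≤ 5 → cArr (suc i) ℕ.+ bArr (suc i) ≡ 55 → Dist G u v (suc i) →
            ∃ λ j → j ∈ near (suc i) × Dist G u w j
    inner i i<4 total uv
      with neighbours v | c-card i (ℕ.<⇒≤ i<4) (Dist-sym uv) | b-card (suc i) i<4 (Dist-sym uv)
    ... | ns , ns! , ns⇔ , |ns| | cs , cs! , cs⇔ , |cs| | bs , bs! , bs⇔ , |bs| =
      [ (λ w∈cs → i , here refl , proj₂ (cs⇒ w∈cs))
      , (λ w∈bs → suc (suc i) , there (here refl) , proj₂ (bs⇒ w∈bs))
      ]′ (∈-++⁻ cs (unique⊆-full (Unique.++⁺ cs! bs! disjoint) ⊆ns (ℕ.≤-reflexive lengths)
            (Equivalence.from (ns⇔ w) (Adj⇒Dist₁ e , Adj⇒Dist₁ e))))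
      where
      cs⇒ : ∀ {z} → z ∈ cs → Dist G v z 1 × Dist G u z i
      cs⇒ = Equivalence.to (cs⇔ _)
      bs⇒ : ∀ {z} → z ∈ bs → Dist G v z 1 × Dist G u z (suc (suc i))
      bs⇒ = Equivalence.to (bs⇔ _)
      disjoint : ∀ {z} → ¬ (z ∈ cs × z ∈ bs)
      disjoint (z∈cs , z∈bs) = ℕ.<⇒≢ (ℕ.m<n⇒m<1+n (ℕ.n<1+n i))
        (Dist-unique (proj₂ (cs⇒ z∈cs)) (proj₂ (bs⇒ z∈bs)))
      ⊆ns : ∀ {z} → z ∈ cs ++ bs → z ∈ ns
      ⊆ns z∈ = Equivalence.from (ns⇔ _) (vz , vz)
        where vz = [ proj₁ ∘ cs⇒ , proj₁ ∘ bs⇒ ]′ (∈-++⁻ cs z∈)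
      lengths : length ns ≡ length (cs ++ bs)
      lengths = trans |ns| (sym (trans (length-++ cs) (trans (cong₂ ℕ._+_ |cs| |bs|) total)))

    -- At distance 5, c₅ = 55 is already the valency, so every neighbour lies at distance 4.
    antipode : Dist G u v 5 → ∃ λ j → j ∈ near 5 × Dist G u w j
    antipode uv with neighbours v | c-card 4 ℕ.≤-refl (Dist-sym uv)
    ... | ns , ns! , ns⇔ , |ns| | cs , cs! , cs⇔ , |cs| =
      4 , here refl , proj₂ (Equivalence.to (cs⇔ w) (unique⊆-full cs!
        (λ z∈cs → let vz = proj₁ (Equivalence.to (cs⇔ _) z∈cs) in Equivalence.from (ns⇔ _) (vz , vz))
        (ℕ.≤-reflexive (trans |ns| (sym |cs|)))
        (Equivalence.from (ns⇔ w) (Adj⇒Dist₁ e , Adj⇒Dist₁ e))))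

    split : ∀ i → suc i ≤ 5 → Dist G u v (suc i) → ∃ λ j → j ∈ near (suc i) × Dist G u w j
    split 0 _ = inner 0 (s≤s (s≤s z≤n)) refl
    split 1 _ = inner 1 (s≤s (s≤s (s≤s z≤n))) refl
    split 2 _ = inner 2 (s≤s (s≤s (s≤s (s≤s z≤n)))) refl
    split 3 _ = inner 3 ℕ.≤-refl refl
    split 4 _ = antipode
    split (suc (suc (suc (suc (suc _))))) (s≤s (s≤s (s≤s (s≤s (s≤s ())))))

  -- Connectedness yields walks, not shortest ones. Following a walk with `adj-near` produces the
  -- distance at each vertex; this makes `d` a function and, through the test `d u v` = 0, equality
  -- of vertices decidable.
  walk-dist : ∀ {u v k} → Walk G u v k → ∃ λ j → Dist G v u j
  walk-dist here        = 0 , Dist-refl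
  walk-dist (step e vs) with adj-near (proj₂ (walk-dist vs)) (symm e)
  ... | j , _ , vu = j , vu

  d : V → V → ℕ
  d u v = proj₁ (walk-dist (proj₂ (connected v u)))

  d-Dist : ∀ u v → Dist G u v (d u v)
  d-Dist u v = proj₂ (walk-dist (proj₂ (connected v u)))

  d-≡ : ∀ {u v k} → Dist G u v k → d u v ≡ k
  d-≡ = Dist-unique (d-Dist _ _)

  Dist-of : ∀ {u v k} → d u v ≡ k → Dist G u v k
  Dist-of refl = d-Dist _ _

  d-sym : ∀ u v → d u v ≡ d v u
  d-sym u v = d-≡ (Dist-sym (d-Dist v u))

  d-bound : ∀ u v → d u v ≤ 5
  d-bound u v = d≤5 u v _ (d-Dist u v)

  d-near : ∀ u {v w} → d v w ≡ 1 → d u w ∈ near (d u v)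
  d-near u {v} vw≡1 with adj-near (d-Dist u v) (Dist₁⇒Adj (Dist-of vw≡1))
  ... | j , j∈ , uw = subst (_∈ near (d u v)) (sym (d-≡ uw)) j∈

  _≟ⱽ_ : (u v : V) → Dec (u ≡ v)
  u ≟ⱽ v with d u v ℕ.≟ 0
  ... | yes eq = yes (Dist₀⇒≡ (Dist-of eq))
  ... | no neq = no λ { refl → neq (d-≡ Dist-refl) }

  -- Enumeration of the vertices, and counting by sums.

  base : V
  base = proj₁ (proj₂ (proj₁ (proj₂ drg)))

  sphere : ∀ i → i ≤ 5 → HasCard (λ w → Dist G base w i × Dist G base w i) (p-numbers 0 i i)
  sphere i i≤5 = card 0 i i z≤n i≤5 i≤5 base base Dist-refl

  ball : ∀ i → i ≤ 5 → List V
  ball zero    i≤5 = proj₁ (sphere zero i≤5)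
  ball (suc i) i≤5 = proj₁ (sphere (suc i) i≤5) ++ ball i (ℕ.<⇒≤ i≤5)

  ball-complete : ∀ i (i≤5 : i ≤ 5) {w j} → j ≤ i → Dist G base w j → w ∈ ball i i≤5
  ball-complete zero    i≤5 z≤n bw = Equivalence.from (proj₁ (proj₂ (proj₂ (sphere zero i≤5))) _) (bw , bw)
  ball-complete (suc i) i≤5 {w} {j} j≤i bw with j ℕ.≟ suc i
  ... | yes refl = ∈-++⁺ˡ (Equivalence.from (proj₁ (proj₂ (proj₂ (sphere (suc i) i≤5))) _) (bw , bw))
  ... | no j≢    = ∈-++⁺ʳ (proj₁ (sphere (suc i) i≤5))
                     (ball-complete i (ℕ.<⇒≤ i≤5) (ℕ.≤-pred (ℕ.≤∧≢⇒< j≤i j≢)) bw)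

  vs : List V
  -- Repetitions are removed by the equality test derived from distances, which yields `vs-unique`
  -- at once.
  vs = deduplicate _≟ⱽ_ (ball 5 ℕ.≤-refl)

  ∈vs : ∀ v → v ∈ vs
  ∈vs v = ∈-deduplicate⁺ _≟ⱽ_ (ball-complete 5 ℕ.≤-refl (d-bound base v) (d-Dist base v))

  vs-unique : Unique vs
  vs-unique = UniqueDec.deduplicate-! _≟ⱽ_ (ball 5 ℕ.≤-refl)

  -- The filtered `vs` and the list from `HasCard` are duplicate-free and contain each other, so
  -- their lengths agree.
  ∑-card : ∀ {P : Pred V p} (P? : Decidable P) {n} → HasCard P n → ∑ vs (λ z → [ P? z ?]) ≡ + n
  ∑-card P? (xs , xs! , xs⇔ , |xs|) = trans (∑-indicator vs P?) (cong +_ (trans (ℕ.≤-antisym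
    (unique⊆-length (Unique.filter⁺ P? vs-unique)
      (λ z∈ → Equivalence.from (xs⇔ _) (proj₂ (∈-filter⁻ P? {xs = vs} z∈))))
    (unique⊆-length xs! (λ z∈ → ∈-filter⁺ P? (∈vs _) (Equivalence.to (xs⇔ _) z∈)))) |xs|))

  ∑-δδ : ∀ {i j x y n} → HasCard (λ z → Dist G x z i × Dist G y z j) n →
         ∑ vs (λ z → δ i (d x z) * δ j (d y z)) ≡ + n
  ∑-δδ {i} {j} {x} {y} (zs , zs! , zs⇔ , |zs|) = trans
    (∑-cong vs λ z → product (i ℕ.≟ d x z) (j ℕ.≟ d y z))
    (∑-card (λ z → i ℕ.≟ d x z ×-dec j ℕ.≟ d y z) (zs , zs! , equiv , |zs|))
    where
    product : ∀ {p q} {P : Set p} {Q : Set q} (P? : Dec P) (Q? : Dec Q) → [ P? ?] * [ Q? ?] ≡ [ P? ×-dec Q? ?]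
    product P? Q? with does P? | does Q?
    ... | true  | true  = refl
    ... | true  | false = refl
    ... | false | _     = refl
    equiv : ∀ z → z ∈ zs ⇔ (i ≡ d x z × j ≡ d y z)
    equiv z = mk⇔
      (λ z∈ → let xz , yz = Equivalence.to (zs⇔ z) z∈ in sym (d-≡ xz) , sym (d-≡ yz))
      (λ (xz , yz) → Equivalence.from (zs⇔ z) (Dist-of (sym xz) , Dist-of (sym yz)))

  ∑-δ₀ : ∀ x → ∑ vs (λ z → δ 0 (d x z)) ≡ 1ℤ
  ∑-δ₀ x = ∑-card (λ z → 0 ℕ.≟ d x z) ([ x ] , [] ∷ [] , (λ z → mk⇔
    (λ { (here refl) → sym (d-≡ Dist-refl) ; (there ()) })
    (λ eq → here (sym (Dist₀⇒≡ (Dist-of (sym eq)))))) , refl)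

  -- Matrix products in the Bose-Mesner algebra.

  -- With `h` = `d x y`, a neighbour of `x` lies at distance `h` - 1 or `h` + 1 from `y`; cₕ and bₕ
  -- count the two kinds.
  neighbour-sum : ∀ g x y → ∑ vs (λ z → δ 1 (d x z) * g (d y z)) ≡ T g (d x y)
  neighbour-sum g x y = by-distance (d x y) refl
    where
    open ≡-Reasoning
    up : ∀ h → d x y ≡ h → ∑ vs (λ z → δ 1 (d x z) * δ (suc h) (d y z)) ≡ + bArr h
    up h eq with suc h ℕ.≤? 5
    ... | yes h<5 = ∑-δδ (b-card h h<5 (Dist-of eq))
    -- Here `h` is 5 and no vertex lies at distance 6, in agreement with the default 0 of `bArr`.
    ... | no  h≮5 = trans (trans (∑-cong vs λ z → trans (cong (δ 1 (d x z) *_)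
        (δ-miss λ { e → h≮5 (subst (_≤ 5) (sym e) (d-bound y z)) })) (ℤ.*-zeroʳ (δ 1 (d x z)))) (∑-zero vs))
        (cong +_ (sym (b-zero h h≮5)))
      where
      b-zero : ∀ h → ¬ suc h ≤ 5 → bArr h ≡ 0
      b-zero 0 h≮5 = contradiction (s≤s z≤n) h≮5
      b-zero 1 h≮5 = contradiction (s≤s (s≤s z≤n)) h≮5
      b-zero 2 h≮5 = contradiction (s≤s (s≤s (s≤s z≤n))) h≮5
      b-zero 3 h≮5 = contradiction (s≤s (s≤s (s≤s (s≤s z≤n)))) h≮5
      b-zero 4 h≮5 = contradiction (s≤s (s≤s (s≤s (s≤s (s≤s z≤n))))) h≮5
      b-zero (suc (suc (suc (suc (suc _))))) _ = refl

    scaled : ∀ j n → ∑ vs (λ z → δ 1 (d x z) * δ j (d y z)) ≡ + n →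
             ∑ vs (λ z → δ 1 (d x z) * δ j (d y z) * g j) ≡ + n * g j
    scaled j n eq = trans (∑-*ʳ vs (g j) _) (cong (_* g j) eq)

    d-near′ : ∀ z → d x z ≡ 1 → d y z ∈ near (d x y)
    d-near′ z xz = subst (λ h → d y z ∈ near h) (d-sym y x) (d-near y xz)

    by-distance : ∀ h → d x y ≡ h → ∑ vs (λ z → δ 1 (d x z) * g (d y z)) ≡ T g h
    by-distance zero eq = trans (∑-cong vs pointwise) (scaled 1 (bArr 0) (up 0 eq))
      where
      neighbour : ∀ {j} → j ∈ near 0 → g j ≡ δ 1 j * g 1
      neighbour (here refl) = sym (ℤ.*-identityˡ (g 1))
      pointwise : ∀ z → δ 1 (d x z) * g (d y z) ≡ δ 1 (d x z) * δ 1 (d y z) * g 1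
      pointwise z = trans
        (δ-cong 1 λ xz → neighbour (subst (λ h → d y z ∈ near h) eq (d-near′ z xz)))
        (sym (ℤ.*-assoc (δ 1 (d x z)) _ _))
    by-distance (suc h) eq = begin
      ∑ vs (λ z → δ 1 (d x z) * g (d y z))
        ≡⟨ ∑-cong vs pointwise ⟩
      ∑ vs (λ z → δ 1 (d x z) * δ h (d y z) * g h + δ 1 (d x z) * δ (suc (suc h)) (d y z) * g (suc (suc h)))
        ≡⟨ ∑-+ vs _ _ ⟩
      ∑ vs (λ z → δ 1 (d x z) * δ h (d y z) * g h)
        + ∑ vs (λ z → δ 1 (d x z) * δ (suc (suc h)) (d y z) * g (suc (suc h)))
        ≡⟨ cong₂ _+_
             (scaled h (cArr (suc h)) (∑-δδ (c-card h (subst (_≤ 5) eq (d-bound x y)) (Dist-of eq))))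
             (scaled (suc (suc h)) (bArr (suc h)) (up (suc h) eq)) ⟩
      T g (suc h) ∎
      where
      pointwise : ∀ z → δ 1 (d x z) * g (d y z) ≡
        δ 1 (d x z) * δ h (d y z) * g h + δ 1 (d x z) * δ (suc (suc h)) (d y z) * g (suc (suc h))
      pointwise z = trans
        (δ-cong 1 λ xz → near-expand g (subst (λ h → d y z ∈ near h) eq (d-near′ z xz)))
        (distrib (δ 1 (d x z)) (δ h (d y z)) (g h) (δ (suc (suc h)) (d y z)) (g (suc (suc h))))
        where
        distrib : ∀ i j k l m → i * (j * k + l * m) ≡ i * j * k + i * l * m
        distrib = solve-∀

  -- Induction along Horner's scheme: the constant term contributes through the identity matrix, and
  -- in the remainder one adjacency factor moves outside by associativity of the matrix product.
  convolution : ∀ cs g x y → ∑ vs (λ z → act cs (δ 0) (d x z) * g (d y z)) ≡ act cs g (d x y)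
  convolution []       g x y = ∑-zero vs
  convolution (c ∷ cs) g x y = begin
    ∑ vs (λ z → (c * δ 0 (d x z) + T q (d x z)) * g (d y z))
      ≡⟨ ∑-cong vs (λ z → distrib c (δ 0 (d x z)) (T q (d x z)) (g (d y z))) ⟩
    ∑ vs (λ z → c * (δ 0 (d x z) * g (d y z)) + T q (d x z) * g (d y z))
      ≡⟨ trans (∑-+ vs _ _) (cong (_+ ∑ vs (λ z → T q (d x z) * g (d y z))) (∑-*ˡ vs c _)) ⟩
    c * ∑ vs (λ z → δ 0 (d x z) * g (d y z)) + ∑ vs (λ z → T q (d x z) * g (d y z))
      ≡⟨ cong₂ (λ s t → c * s + t) diagonal shifted ⟩
    c * g (d x y) + T (act cs g) (d x y) ∎
    where
    open ≡-Reasoning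
    q : ℕ → ℤ
    q = act cs (δ 0)

    distrib : ∀ c s t g → (c * s + t) * g ≡ c * (s * g) + t * g
    distrib = solve-∀

    diagonal : ∑ vs (λ z → δ 0 (d x z) * g (d y z)) ≡ g (d x y)
    diagonal = begin
      ∑ vs (λ z → δ 0 (d x z) * g (d y z))  ≡⟨ ∑-cong vs pointwise ⟩
      ∑ vs (λ z → δ 0 (d x z) * g (d x y))  ≡⟨ ∑-*ʳ vs (g (d x y)) _ ⟩
      ∑ vs (λ z → δ 0 (d x z)) * g (d x y)  ≡⟨ cong (_* g (d x y)) (∑-δ₀ x) ⟩
      1ℤ * g (d x y)                        ≡⟨ ℤ.*-identityˡ _ ⟩
      g (d x y)                             ∎
      where
      pointwise : ∀ z → δ 0 (d x z) * g (d y z) ≡ δ 0 (d x z) * g (d x y)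
      pointwise z = δ-cong 0 λ xz → cong g
        (trans (cong (d y) (sym (Dist₀⇒≡ (Dist-of xz)))) (d-sym y x))

    shifted : ∑ vs (λ z → T q (d x z) * g (d y z)) ≡ T (act cs g) (d x y)
    shifted = begin
      ∑ vs (λ z → T q (d x z) * g (d y z))
        ≡⟨ ∑-cong vs (λ z → trans (cong (_* g (d y z)) (sym (neighbour-sum q x z))) (sym (∑-*ʳ vs (g (d y z)) _))) ⟩
      ∑ vs (λ z → ∑ vs λ w → δ 1 (d x w) * q (d z w) * g (d y z))
        ≡⟨ ∑-comm vs vs _ ⟩
      ∑ vs (λ w → ∑ vs λ z → δ 1 (d x w) * q (d z w) * g (d y z))
        ≡⟨ ∑-cong vs (λ w → trans
             (∑-cong vs λ z → trans (ℤ.*-assoc (δ 1 (d x w)) _ _)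
               (cong (λ h → δ 1 (d x w) * (q h * g (d y z))) (d-sym z w)))
             (∑-*ˡ vs (δ 1 (d x w)) _)) ⟩
      ∑ vs (λ w → δ 1 (d x w) * ∑ vs λ z → q (d w z) * g (d y z))
        ≡⟨ ∑-cong vs (λ w → cong (δ 1 (d x w) *_)
             (trans (convolution cs g w y) (cong (act cs g) (d-sym w y)))) ⟩
      ∑ vs (λ w → δ 1 (d x w) * act cs g (d y w))
        ≡⟨ neighbour-sum (act cs g) x y ⟩
      T (act cs g) (d x y) ∎

  open Kernels vs

  -- Reduces a sum of products over the vertices to evaluating an integer function at a single
  -- distance.
  polynomial-sum : ∀ φ ψ → IsPolynomial φ → ∀ x y →
    ∑ vs (λ z → φ (d x z) * ψ (d y z)) * scale ≡ act (polynomial φ) ψ (d x y)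
  polynomial-sum φ ψ poly x y = begin
    ∑ vs (λ z → φ (d x z) * ψ (d y z)) * scale
      ≡⟨ sym (∑-*ʳ vs scale _) ⟩
    ∑ vs (λ z → φ (d x z) * ψ (d y z) * scale)
      ≡⟨ ∑-cong vs (λ z → trans (swap (φ (d x z)) (ψ (d y z)) scale)
           (cong (_* ψ (d y z)) (poly (d-bound x z)))) ⟩
    ∑ vs (λ z → act (polynomial φ) (δ 0) (d x z) * ψ (d y z))
      ≡⟨ convolution (polynomial φ) ψ x y ⟩
    act (polynomial φ) ψ (d x y) ∎
    where
    open ≡-Reasoning
    swap : ∀ i j k → i * j * k ≡ i * k * j
    swap = solve-∀

  -- The vanishing Krein parameters.

  reproducing : ∀ c φ → IsPolynomial φ → IsIdempotent c φ → Reproducing c (λ x y → φ (d x y))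
  reproducing c φ poly idem x y = trans
    (∑-cong vs λ u → cong₂ (λ h h′ → φ h * φ h′) (d-sym u x) (d-sym u y))
    (ℤ.*-cancelʳ-≡ (∑ vs λ u → φ (d x u) * φ (d y u)) (φ (d x y) * c) scale
      (trans (polynomial-sum φ φ poly x y) (idem (d-bound x y))))

  -- Row `x` sums to the diagonal entry at `x` of the product of the matrices `φ` and `ψ`.
  ∑²-product-zero : ∀ φ ψ → IsPolynomial φ → act (polynomial φ) ψ 0 ≡ 0ℤ →
    ∑² (λ x y → φ (d x y) * ψ (d x y)) ≡ 0ℤ
  ∑²-product-zero φ ψ poly eq = trans (∑-cong vs row) (∑-zero vs)
    where
    row : ∀ x → ∑ vs (λ y → φ (d x y) * ψ (d x y)) ≡ 0ℤ
    row x = ℤ.*-cancelʳ-≡ (∑ vs λ y → φ (d x y) * ψ (d x y)) 0ℤ scale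
      (trans (polynomial-sum φ ψ poly x x) (trans (cong (act (polynomial φ) ψ) (d-≡ Dist-refl)) eq))

  -- The spheres of radius 0, 1, 3, 5 have 1, 55, 1485, 210 vertices and `f` vanishes at distances 2
  -- and 4, so a row gives 198² · 125 - 55 · 72² · 14 + 1485 · 2² - 210 · 33² · 4 = 0.
  krein-zero : ∑² (λ x y → g (d x y) * g (d x y) * f (d x y)) ≡ 0ℤ
  krein-zero = trans (∑²-cong λ x y → ℤ.*-assoc (g (d x y)) (g (d x y)) (f (d x y)))
    (∑²-product-zero g (λ h → g h * f h) g-polynomial refl)

  ggf-vanishes : ∀ u v w → ∑ vs (λ x → g (d u x) * g (d v x) * f (d w x)) ≡ 0ℤ
  ggf-vanishes u v w = triple-product-vanishes (+ 5250) (+ 5250) (+ 250)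
    (λ x y → g (d x y)) (λ x y → g (d x y)) (λ x y → f (d x y))
    (reproducing (+ 5250) g g-polynomial g-idempotent)
    (reproducing (+ 5250) g g-polynomial g-idempotent)
    (reproducing (+ 250) f f-polynomial f-idempotent)
    krein-zero (∈vs u) (∈vs v) (∈vs w)

  -- Three vertices at pairwise distance 2.

  sum-at-distance-2 : ∀ φ ψ n → IsPolynomial φ → act (polynomial φ) ψ 2 ≡ n * scale →
    ∀ {x y} → d x y ≡ 2 → ∑ vs (λ z → φ (d x z) * ψ (d y z)) ≡ n
  sum-at-distance-2 φ ψ n poly eq {x} {y} xy = ℤ.*-cancelʳ-≡ (∑ vs λ z → φ (d x z) * ψ (d y z)) n scale
    (trans (polynomial-sum φ ψ poly x y) (trans (cong (act (polynomial φ) ψ) xy) eq))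

  ∑-pairwise : ∀ {u v w} → d u v ≡ 2 → d w u ≡ 2 → d w v ≡ 2 →
    ∑ vs (λ z → pairwise (d u z) (d v z) (d w z)) ≡ + 122500
  ∑-pairwise {u} {v} {w} uv wu wv =
    -- 60375 = 5250 · 23 / 2, because the part of `g-odd` in the eigenspace of -20 is orthogonal to
    -- `g`.
    split (sum-at-distance-2 g-odd g (+ 60375) g-odd-polynomial refl uv) (
    -- The row sum of `k`: 66125 - 60 · 55 - 20 · 210 = 58625.
    split (sum-at-distance-2 k (λ _ → 1ℤ) (+ 58625) k-polynomial refl wu) (
    split
      -- The values 0, 5, 35 are the intersection numbers p²₀₀, p²₁₁, p²₅₅. In all, 60375 + 58625 -
      -- 2100 · 10 + 350 · 70 = 122500.
      (scaled (+ 5000000) (split (sum-at-distance-2 (δ 0) (δ 0) 0ℤ δ₀-polynomial refl wu)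
                                 (sum-at-distance-2 (δ 0) (δ 0) 0ℤ δ₀-polynomial refl wv))) (
    split
      (scaled (- + 2100) (split (sum-at-distance-2 (δ 1) (δ 1) (+ 5) δ₁-polynomial refl wu)
                                (sum-at-distance-2 (δ 1) (δ 1) (+ 5) δ₁-polynomial refl wv)))
      (scaled (+ 350)    (split (sum-at-distance-2 (δ 5) (δ 5) (+ 35) δ₅-polynomial refl wu)
                                (sum-at-distance-2 (δ 5) (δ 5) (+ 35) δ₅-polynomial refl wv))))))
    where
    split : ∀ {s t : V → ℤ} {m n} → ∑ vs s ≡ m → ∑ vs t ≡ n → ∑ vs (λ z → s z + t z) ≡ m + n
    split {s} {t} s≡ t≡ = trans (∑-+ vs s t) (cong₂ _+_ s≡ t≡)
    scaled : ∀ c {s : V → ℤ} {m} → ∑ vs s ≡ m → ∑ vs (λ z → s z * c) ≡ m * c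
    scaled c {s} s≡ = trans (∑-*ʳ vs c s) (cong (_* c) s≡)

  -- The two vertices are `x` and `y` themselves; being at distance 2 they are distinct, so their
  -- indicators never overlap.
  two-common-neighbours : ∀ {x y u v w} → d x y ≡ 2 →
    d x u ≡ 1 → d x v ≡ 1 → d x w ≡ 1 → d y u ≡ 1 → d y v ≡ 1 → d y w ≡ 1 →
    + 2 ℤ.≤ ∑ vs (λ z → common (d u z) (d v z) (d w z))
  two-common-neighbours {x} {y} {u} {v} {w} xy xu xv xw yu yv yw = subst (ℤ._≤ ∑ vs _)
    (trans (∑-+ vs _ _) (cong₂ _+_ (∑-δ₀ x) (∑-δ₀ y))) (∑-mono vs pointwise)
    where
    one : ∀ {z} → d z u ≡ 1 → d z v ≡ 1 → d z w ≡ 1 → common (d u z) (d v z) (d w z) ≡ 1ℤ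
    one {z} zu zv zw rewrite d-sym u z | d-sym v z | d-sym w z | zu | zv | zw = refl
    pointwise : ∀ z → δ 0 (d x z) + δ 0 (d y z) ℤ.≤ common (d u z) (d v z) (d w z)
    pointwise z with d x z ℕ.≟ 0 | d y z ℕ.≟ 0
    ... | no xz≢0 | no yz≢0 rewrite δ-miss (xz≢0 ∘ sym) | δ-miss (yz≢0 ∘ sym) = common-nonNeg (d u z) (d v z) (d w z)
    ... | yes xz≡0 | _ with Dist₀⇒≡ (Dist-of xz≡0)
    ...   | refl rewrite xz≡0 | d-sym y x | xy | one xu xv xw = ℤ.≤-refl
    pointwise z | no xz≢0 | yes yz≡0 with Dist₀⇒≡ (Dist-of yz≡0)
    ...   | refl rewrite yz≡0 | xy | one yu yv yw = ℤ.≤-refl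

  siblings : ∀ {x u v} → d x u ≡ 1 → d x v ≡ 1 → u ≢ v → d u v ≡ 2
  siblings {x} {u} {v} xu xv u≢v
    with subst (λ m → d u v ∈ near m) (trans (d-sym u x) xu) (d-near u xv)
  ... | here uv≡0         = contradiction (Dist₀⇒≡ (Dist-of uv≡0)) u≢v
  ... | there (here uv≡2) = uv≡2

  -- The sum α of `common` satisfies 73500 α ≤ 122500, whereas `x` and `y` force α ≥ 2.
  no-three-common-neighbours : ∀ {x y u v w} → d x y ≡ 2 →
    d x u ≡ 1 → d x v ≡ 1 → d x w ≡ 1 → d y u ≡ 1 → d y v ≡ 1 → d y w ≡ 1 →
    u ≢ v → w ≢ u → w ≢ v → ⊥
  no-three-common-neighbours {x} {y} {u} {v} {w} xy xu xv xw yu yv yw u≢v w≢u w≢v =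
    toWitnessFalse {a? = + 147000 ℤ.≤? + 122500} _ (begin
      + 2 * + 73500
        ≤⟨ ℤ.*-monoʳ-≤-nonNeg (+ 73500) (two-common-neighbours xy xu xv xw yu yv yw) ⟩
      ∑ vs (λ z → common (d u z) (d v z) (d w z)) * + 73500
        ≡⟨ sym (trans (∑-+ vs _ _) (trans
             (cong₂ _+_ (ggf-vanishes u v w) (∑-*ʳ vs (+ 73500) _)) (ℤ.+-identityˡ _))) ⟩
      ∑ vs (λ z → g (d u z) * g (d v z) * f (d w z) + common (d u z) (d v z) (d w z) * + 73500)
        -- As `u`, `v`, `w` are neighbours of `x`, their distances from `z` all lie in
        -- `near (d z x)`: they have equal parity and differ by at most 2.
        ≤⟨ ∑-mono vs (λ z → ternary-bound (d-bound z x) (at z xu) (at z xv) (at z xw)) ⟩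
      ∑ vs (λ z → pairwise (d u z) (d v z) (d w z))
        ≡⟨ ∑-pairwise (siblings xu xv u≢v) (siblings xw xu w≢u) (siblings xw xv w≢v) ⟩
      + 122500 ∎)
    where
    open ℤ.≤-Reasoning
    at : ∀ z {u} → d x u ≡ 1 → d u z ∈ near (d z x)
    at z {u} xu = subst (_∈ near (d z x)) (d-sym z u) (d-near z xu)

  distance-2-pair : ∃ λ x → ∃ λ y → d x y ≡ 2
  distance-2-pair with neighbours base
  ... | x ∷ _ , _ , ns⇔ , _ with b-card 1 (s≤s (s≤s z≤n)) (proj₁ (Equivalence.to (ns⇔ x) (here refl)))
  ...   | y ∷ _ , _ , ys⇔ , _ = x , y , d-≡ (proj₂ (Equivalence.to (ys⇔ y) (here refl)))

  absurd : ⊥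
  absurd with distance-2-pair
  ... | x , y , xy with c-card 1 (s≤s (s≤s z≤n)) (Dist-of xy)
  -- c₂ = 5 leaves only lists with at least three entries.
  ...   | u ∷ v ∷ w ∷ _ , (u≢v ∷ u≢w ∷ _) ∷ (v≢w ∷ _) ∷ _ , ns⇔ , _ =
    no-three-common-neighbours xy
      (d-≡ (proj₁ nu)) (d-≡ (proj₁ nv)) (d-≡ (proj₁ nw))
      (d-≡ (proj₂ nu)) (d-≡ (proj₂ nv)) (d-≡ (proj₂ nw))
      u≢v (u≢w ∘ sym) (v≢w ∘ sym)
    where
    nu : Dist G x u 1 × Dist G y u 1
    nu = Equivalence.to (ns⇔ u) (here refl)
    nv : Dist G x v 1 × Dist G y v 1
    nv = Equivalence.to (ns⇔ v) (there (here refl))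
    nw : Dist G x w 1 × Dist G y w 1
    nw = Equivalence.to (ns⇔ w) (there (there (here refl)))

theorem7 : ∀ {a ℓ} {V : Set a} (G : Graph V ℓ) → ¬ DistanceRegularWithArray G 5 bArr cArr
theorem7 G drg = Distances.absurd G drg
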